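{- Let $f(X)=AX+\frac{C}{X}$. Suppose there exist nonzero integers $A,C$ and a nonzero rational number $z$ such that the quartic curve \[C_4:\ v^2=-4A^3Cz^4y^4+(A^4z^8+4A^3Cz^6-2A^2C^2z^4+4AC^3z^2+C^4)y^2-4AC^3z^4\] has infinitely many rational points $(y,v)$. Then the equation $f(x)f(y)=f(z)^2$ has infinitely many nontrivial rational solutions $(x,y,z)$.
   Context: A solution $(x,y,z)$ (with $x,y,z$ nonzero rationals, so that $f$ is defined) of $f(x)f(y)=f(z)^2$ is called nontrivial if $f(x)\neq f(y)$ and $f(z)\neq 0$. -}

module Defs where

import Algebra.Definitions.RawSemiring
open import Data.Integer.Base as ℤ using (ℤ; +_)
open import Data.List.Base using (List)
open import Data.List.Membership.Propositional using (_∉_)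
open import Data.Product.Base using (_×_; _,_; ∃-syntax)
open import Data.Rational.Base
  using (ℚ; 0ℚ; NonZero; _+_; _*_; _-_; -_; _÷_; _/_; +-*-rawSemiring)
open import Level using (Level; 0ℓ; _⊔_)
open import Relation.Binary.PropositionalEquality.Core using (_≡_; _≢_)
open import Relation.Unary using (Pred)

open Algebra.Definitions.RawSemiring +-*-rawSemiring using (_^_)

private
  variable
    a p : Level

-- No finite list exhausts P.  For a type with decidable equality, such as
-- pairs or triples of rationals, iterating this yields an injective sequence
-- of elements satisfying P, and conversely.
Infinite : {X : Set a} → Pred X p → Set (a ⊔ p)
Infinite {X = X} P = ∀ (xs : List X) → ∃[ x ] x ∉ xs × P x

fromℤ : ℤ → ℚ
fromℤ n = n / 1

f : (A C : ℤ) (X : ℚ) → .{{NonZero X}} → ℚ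
f A C X = fromℤ A * X + fromℤ C ÷ X

record IsNontrivialSolution (A C : ℤ) (x y z : ℚ) : Set where
  field
    {{x-nonZero}} : NonZero x
    {{y-nonZero}} : NonZero y
    {{z-nonZero}} : NonZero z
    equation      : f A C x * f A C y ≡ f A C z ^ 2
    fx≢fy         : f A C x ≢ f A C y
    fz≢0          : f A C z ≢ 0ℚ

NontrivialSolution : (A C : ℤ) → Pred (ℚ × ℚ × ℚ) 0ℓ
NontrivialSolution A C (x , y , z) = IsNontrivialSolution A C x y z

-- Affine rational points (y , v) of the quartic C₄.
C₄ : (A C : ℤ) (z : ℚ) → Pred (ℚ × ℚ) 0ℓ
C₄ A C z (y , v) =
  v ^ 2 ≡ - 4ℚ * α ^ 3 * γ * z ^ 4 * y ^ 4
        + ( α ^ 4 * z ^ 8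
          + 4ℚ * α ^ 3 * γ * z ^ 6
          - 2ℚ * α ^ 2 * γ ^ 2 * z ^ 4
          + 4ℚ * α * γ ^ 3 * z ^ 2
          + γ ^ 4
          ) * y ^ 2
        - 4ℚ * α * γ ^ 3 * z ^ 4
  where
  α γ 2ℚ 4ℚ : ℚ
  α  = fromℤ A
  γ  = fromℤ C
  2ℚ = fromℤ (+ 2)
  4ℚ = fromℤ (+ 4)

{-# OPTIONS --safe #-}

-- For fixed z and y, clearing denominators in f(x) f(y) = f(z)² gives a quadratic
-- equation in x whose discriminant is the right-hand side of C₄.  If y (A y² + C) ≠ 0,
-- a point (y , v) thus yields a rational x, and (x,y,z) is nontrivial unless f(z) = 0 or
-- f(y) = ± f(z); the latter happens only for y = ± z and y = ± C/(Az).
--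
-- If f(z) = 0, the points of C₄ yield no nontrivial solution.  But then
-- C = - A z², so after rescaling f becomes X - 1/X and z may be replaced by 7z/3:
-- the resulting quartic is isomorphic to U² = a² (X⁴ + Z⁴) + b X² Z² with a = 441
-- and b = 251038.  Starting from (X : Z : U) = (54 : 61 : 2659005), each
-- duplication raises the 2-adic valuation of X/Z by one, so that infinitely many
-- points arise.
module Submission where

open import Defs
open import Data.Integer.Base using (ℤ; 0ℤ)
open import Data.Product.Base using (_×_; ∃-syntax)
open import Data.Rational.Base using (0ℚ)
open import Relation.Binary.PropositionalEquality.Core using (_≢_)

open import Data.List.Base using (List; []; _∷_; map; _++_)
open import Data.List.Extrema.Nat using (max; xs≤max)
open import Data.List.Membership.Propositional using (_∈_; _∉_)
open import Data.List.Membership.Propositional.Properties using (∈-map⁺; ∈-++⁺ˡ; ∈-++⁺ʳ)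
import Data.List.Relation.Unary.All as All
open import Data.List.Relation.Unary.Any using (here; there)
open import Data.Nat.Base as ℕ using (ℕ; zero; suc)
import Data.Nat.Properties as ℕ
open import Data.Product.Base using (_,_; proj₁; proj₂)
open import Data.Sum.Base as Sum using (_⊎_; inj₁; inj₂; [_,_]′)
open import Function.Base using (_∘_)
open import Level using (Level)
open import Relation.Binary.Definitions using (DecidableEquality)
open import Relation.Binary.PropositionalEquality
open import Relation.Nullary.Decidable using (yes; no)
open import Relation.Unary using (Pred)

-- Projections of infinite sets with finite fibres.

private
  variable
    a b ℓ : Level

-- Finitely many pairs lie over each first coordinate, so finitely many first coordinates cannot
-- account for all pairs. A list covering a fibre is demanded only once a point of that fibre is
-- known, which is all that `C₄-fibre` can offer.
Infinite-dom : {X : Set a} {Y : Set b} {P : Pred (X × Y) ℓ} → DecidableEquality X →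
  (∀ {x y} → P (x , y) → ∃[ ys ] ∀ {y′} → P (x , y′) → y′ ∈ ys) →
  Infinite P → Infinite (λ x → ∃[ y ] P (x , y))
Infinite-dom {X = X} {Y} {P} _≟X_ fibre inf xs =
  let x , x∉xs , y , _ , px = avoid xs [] in x , x∉xs , y , px
  where
  -- The forbidden pairs `zs` make the recursion on `xs` work: if the pair found lies over `x₀`, the
  -- search is repeated with the whole fibre over `x₀` forbidden as well.
  avoid : (xs : List X) (zs : List (X × Y)) →
          ∃[ x ] x ∉ xs × ∃[ y ] (x , y) ∉ zs × P (x , y)
  avoid [] zs = let (x , y) , xy∉zs , pxy = inf zs in x , (λ ()) , y , xy∉zs , pxy
  avoid (x₀ ∷ xs) zs with avoid xs zs
  ... | x , x∉xs , y , xy∉zs , pxy with x ≟X x₀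
  ...   | no  x≢x₀ = x , (λ { (here eq) → x≢x₀ eq ; (there x∈xs) → x∉xs x∈xs }) , y , xy∉zs , pxy
  ...   | yes refl with fibre pxy
  ...     | ys , complete with avoid xs (map (x₀ ,_) ys ++ zs)
  ...       | x′ , x′∉xs , y′ , x′y′∉ , px′y′ =
    x′ ,
    (λ { (here refl) → x′y′∉ (∈-++⁺ˡ (∈-map⁺ (x₀ ,_) (complete px′y′)))
       ; (there x′∈xs) → x′∉xs x′∈xs }) ,
    y′ , x′y′∉ ∘ ∈-++⁺ʳ _ , px′y′

-- Integral points of growing 2-adic valuation on a symmetric quartic.

module 2-AdicPoints where

  open import Data.Integer.Base hiding (suc)
  open import Data.Integer.Properties
  import Data.Integer.Tactic.RingSolver as ℤ-Solver

  Odd : ℤ → Set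
  Odd n = ∃[ k ] n ≡ 1ℤ + + 2 * k

  Odd-* : ∀ {m n} → Odd m → Odd n → Odd (m * n)
  Odd-* (j , refl) (k , refl) = j + k + + 2 * (j * k) , identity j k
    where
    identity : ∀ j k → (1ℤ + + 2 * j) * (1ℤ + + 2 * k) ≡ 1ℤ + + 2 * (j + k + + 2 * (j * k))
    identity = ℤ-Solver.solve-∀

  Odd-+-even : ∀ {m} k → Odd m → Odd (m + + 2 * k)
  Odd-+-even k (j , refl) = j + k , identity j k
    where
    identity : ∀ j k → (1ℤ + + 2 * j) + + 2 * k ≡ 1ℤ + + 2 * (j + k)
    identity = ℤ-Solver.solve-∀

  -- Induction on `n`: with `z = 1 + 2k`, the number `i = i * z - 2 * (k * i)` is even, and one
  -- factor 2 cancels on both sides.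
  odd-cofactor-cancels : ∀ n {z} → Odd z → ∀ {i t} → i * z ≡ (+ 2) ^ n * t → ∃[ s ] i ≡ (+ 2) ^ n * s
  odd-cofactor-cancels zero    _               {i}     _  = i , sym (*-identityˡ i)
  odd-cofactor-cancels (suc n) z-odd@(k , refl) {i} {t} eq =
    let s , j≡2ⁿs = odd-cofactor-cancels n z-odd (*-cancelˡ-≡ (+ 2) (j * (1ℤ + + 2 * k)) ((+ 2) ^ n * t) 2jz≡2^[1+n]t)
    in s , trans i≡2j (trans (cong (+ 2 *_) j≡2ⁿs) (sym (*-assoc (+ 2) ((+ 2) ^ n) s)))
    where
    j = (+ 2) ^ n * t - k * i
    open ≡-Reasoning
    i≡2j : i ≡ + 2 * j
    i≡2j = begin
      i                                      ≡⟨ identity₁ i k ⟩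
      i * (1ℤ + + 2 * k) - + 2 * (k * i)     ≡⟨ cong (_- + 2 * (k * i)) eq ⟩
      (+ 2) ^ suc n * t - + 2 * (k * i)        ≡⟨ identity₂ ((+ 2) ^ n) t k i ⟩
      + 2 * j                                ∎
      where
      identity₁ : ∀ i k → i ≡ i * (1ℤ + + 2 * k) - + 2 * (k * i)
      identity₁ = ℤ-Solver.solve-∀
      identity₂ : ∀ p t k i → + 2 * p * t - + 2 * (k * i) ≡ + 2 * (p * t - k * i)
      identity₂ = ℤ-Solver.solve-∀
    2jz≡2^[1+n]t : + 2 * (j * (1ℤ + + 2 * k)) ≡ + 2 * ((+ 2) ^ n * t)
    2jz≡2^[1+n]t = begin
      + 2 * (j * (1ℤ + + 2 * k))  ≡⟨ *-assoc (+ 2) j _ ⟨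
      + 2 * j * (1ℤ + + 2 * k)    ≡⟨ cong (_* (1ℤ + + 2 * k)) i≡2j ⟨
      i * (1ℤ + + 2 * k)          ≡⟨ eq ⟩
      (+ 2) ^ suc n * t             ≡⟨ *-assoc (+ 2) ((+ 2) ^ n) t ⟩
      + 2 * ((+ 2) ^ n * t)         ∎

  n<2^n : ∀ n → n ℕ.< 2 ℕ.^ n
  n<2^n zero    = ℕ.z<s
  n<2^n (suc n) = begin-strict
    suc n                ≤⟨ n<2^n n ⟩
    2 ℕ.^ n              <⟨ ℕ.m<m+n (2 ℕ.^ n) (ℕ.≤-<-trans ℕ.z≤n (ℕ.<-≤-trans (n<2^n n) (ℕ.m≤m+n _ 0))) ⟩
    2 ℕ.^ suc n          ∎
    where open ℕ.≤-Reasoning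

  ∣2^n∣ : ∀ n → ∣ (+ 2) ^ n ∣ ≡ 2 ℕ.^ n
  ∣2^n∣ zero    = refl
  ∣2^n∣ (suc n) = trans (abs-* (+ 2) ((+ 2) ^ n)) (cong (2 ℕ.*_) (∣2^n∣ n))

  -- Turns divisibility into size, through `n < 2 ^ n`; this is how points of high valuation are
  -- told apart from finitely many others.
  2^n∣i⇒n<∣i∣ : ∀ n {i s} → i ≢ 0ℤ → i ≡ (+ 2) ^ n * s → n ℕ.< ∣ i ∣
  2^n∣i⇒n<∣i∣ n {i} {s} i≢0 eq = subst (n ℕ.<_) (sym ∣i∣≡)
    (ℕ.<-≤-trans (n<2^n n) (ℕ.m≤m*n (2 ℕ.^ n) ∣ s ∣ {{∣s∣-nonZero}}))
    where
    ∣i∣≡ : ∣ i ∣ ≡ 2 ℕ.^ n ℕ.* ∣ s ∣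
    ∣i∣≡ = trans (cong ∣_∣ eq) (trans (abs-* ((+ 2) ^ n) s) (cong (ℕ._* ∣ s ∣) (∣2^n∣ n)))
    ∣s∣-nonZero : ℕ.NonZero ∣ s ∣
    ∣s∣-nonZero = ℕ.≢-nonZero λ ∣s∣≡0 →
      i≢0 (trans eq (trans (cong ((+ 2) ^ n *_) (∣i∣≡0⇒i≡0 ∣s∣≡0)) (*-zeroʳ ((+ 2) ^ n))))

  Odd⇒≢0 : ∀ {n} → Odd n → n ≢ 0ℤ
  Odd⇒≢0 0-odd refl =
    -- Were 0 odd, cancelling it from `1 * 0 = 2 * 0` would make 1 even, and the size bound would
    -- then give 1 < 1.
    ℕ.<-irrefl refl (2^n∣i⇒n<∣i∣ 1 (λ ()) (proj₂ (odd-cofactor-cancels 1 0-odd {1ℤ} {0ℤ} refl)))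

  -- With `c` and `Z` odd, `X/Z` has 2-adic valuation exactly `n + 1`. Oddness of `U` preserves this
  -- under doubling, where `c` becomes `c * Z * U`.
  record DyadicPoint (a b : ℤ) (n : ℕ) : Set where
    field
      c Z U : ℤ
      c-odd : Odd c
      Z-odd : Odd Z
      U-odd : Odd U
    X : ℤ
    X = + 2 * ((+ 2) ^ n * c)
    field
      on-quartic : U * U ≡ a * a * (X * X * (X * X) + Z * Z * (Z * Z)) + b * (X * X * (Z * Z))

    X≢0 : X ≢ 0ℤ
    X≢0 X≡0 with i*j≡0⇒i≡0∨j≡0 (+ 2) X≡0
    ... | inj₂ 2ⁿc≡0 with i*j≡0⇒i≡0∨j≡0 ((+ 2) ^ n) 2ⁿc≡0
    ...   | inj₁ 2ⁿ≡0 = ℕ.≢-nonZero⁻¹ (2 ℕ.^ n) {{ℕ.m^n≢0 2 n}} (trans (sym (∣2^n∣ n)) (cong ∣_∣ 2ⁿ≡0))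
    ...   | inj₂ c≡0  = Odd⇒≢0 c-odd c≡0

    -- Smallness is meant 2-adically: in any fraction `i/j` equal to `X/Z`, reduced or not, the odd
    -- `Z` cancels and leaves `i` divisible by `2 ^ n`, while `i` is nonzero because `X` is.
    X/Z-small : ∀ {i j} → j ≢ 0ℤ → i * Z ≡ X * j → n ℕ.< ∣ i ∣
    X/Z-small {i} {j} j≢0 iZ≡Xj = 2^n∣i⇒n<∣i∣ n i≢0
      (proj₂ (odd-cofactor-cancels n Z-odd (trans iZ≡Xj (identity ((+ 2) ^ n) c j))))
      where
      identity : ∀ p c j → + 2 * (p * c) * j ≡ p * (+ 2 * c * j)
      identity = ℤ-Solver.solve-∀
      i≢0 : i ≢ 0ℤ
      i≢0 refl = [ X≢0 , j≢0 ]′ (i*j≡0⇒i≡0∨j≡0 X (sym iZ≡Xj))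

  -- With Y = X/Z and W = U/(a Z²), this is Y ↦ 2 Y W / (1 - Y⁴), the duplication on
  -- the Jacobi quartic W² = 1 + (b/a²) Y² + Y⁴.
  double : ∀ {a b n} → Odd a → DyadicPoint a b n → DyadicPoint a b (suc n)
  double {a} {b} {n} a-odd pt = record
    { c = c * Z * U
    ; Z = Z′
    ; U = U′
    ; c-odd = Odd-* (Odd-* c-odd Z-odd) U-odd
    ; Z-odd = Z′-odd
    ; U-odd = U′-odd
    ; on-quartic = subst (λ X′ → U′ * U′ ≡ a * a * (X′ * X′ * (X′ * X′) + Z′ * Z′ * (Z′ * Z′)) + b * (X′ * X′ * (Z′ * Z′)))
                     (X′≡ ((+ 2) ^ n) c Z U) on-quartic′
    }
    where
    open DyadicPoint pt
    -- In terms of `S` and `t` the curve reads `U² = a² S + b t`. Once `U²` is replaced accordingly,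
    -- `X′²`, `Z′²` and `U′` are polynomials in `a`, `b`, `S`, `t`, and the new equation is an
    -- identity in these four variables.
    S t X′ Z′ U′ : ℤ
    S  = X * X * (X * X) + Z * Z * (Z * Z)
    t  = X * X * (Z * Z)
    X′ = + 2 * (X * Z * U)
    Z′ = a * (Z * Z * (Z * Z) - X * X * (X * X))
    U′ = a * (S * (a * a * S + + 2 * (b * t)) + + 4 * (a * a * (t * t)))

    X′≡ : ∀ p c Z U → + 2 * (+ 2 * (p * c) * Z * U) ≡ + 2 * (+ 2 * p * (c * Z * U))
    X′≡ = ℤ-Solver.solve-∀

    Z⁴-odd : Odd (Z * Z * (Z * Z))
    Z⁴-odd = Odd-* (Odd-* Z-odd Z-odd) (Odd-* Z-odd Z-odd)

    S-odd : Odd S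
    S-odd = subst Odd (identity ((+ 2) ^ n * c) Z) (Odd-+-even _ Z⁴-odd)
      where
      identity : ∀ ξ Z → let X = + 2 * ξ in
        Z * Z * (Z * Z) + + 2 * (ξ * X * (X * X)) ≡ X * X * (X * X) + Z * Z * (Z * Z)
      identity = ℤ-Solver.solve-∀

    Z′-odd : Odd Z′
    Z′-odd = Odd-* a-odd (subst Odd (identity ((+ 2) ^ n * c) Z) (Odd-+-even _ Z⁴-odd))
      where
      identity : ∀ ξ Z → let X = + 2 * ξ in
        Z * Z * (Z * Z) + + 2 * (- (ξ * X * (X * X))) ≡ Z * Z * (Z * Z) - X * X * (X * X)
      identity = ℤ-Solver.solve-∀

    U′-odd : Odd U′
    U′-odd = Odd-* a-odd (subst Odd (identity a b S t)
      (Odd-+-even _ (Odd-* (Odd-* a-odd a-odd) (Odd-* S-odd S-odd))))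
      where
      identity : ∀ a b S t →
        a * a * (S * S) + + 2 * (b * (S * t) + + 2 * (a * a * (t * t))) ≡
        S * (a * a * S + + 2 * (b * t)) + + 4 * (a * a * (t * t))
      identity = ℤ-Solver.solve-∀

    on-quartic′ : U′ * U′ ≡ a * a * (X′ * X′ * (X′ * X′) + Z′ * Z′ * (Z′ * Z′)) + b * (X′ * X′ * (Z′ * Z′))
    on-quartic′ = begin
      U′ * U′
        ≡⟨ identity a b S t ⟩
      quartic (+ 4 * (t * (a * a * S + b * t))) Z′²
        ≡⟨ cong (λ w → quartic (+ 4 * (t * w)) Z′²) on-quartic ⟨
      quartic (+ 4 * (t * (U * U))) Z′²
        ≡⟨ cong₂ quartic (X′²≡ X Z U) (Z′²≡ a X Z) ⟨
      quartic (X′ * X′) (Z′ * Z′) ∎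
      where
      open ≡-Reasoning
      quartic : ℤ → ℤ → ℤ
      quartic p q = a * a * (p * p + q * q) + b * (p * q)
      Z′² : ℤ
      Z′² = a * a * (S * S - + 4 * (t * t))
      X′²≡ : ∀ X Z U → + 2 * (X * Z * U) * (+ 2 * (X * Z * U)) ≡ + 4 * (X * X * (Z * Z) * (U * U))
      X′²≡ = ℤ-Solver.solve-∀
      Z′²≡ : ∀ a X Z → let S = X * X * (X * X) + Z * Z * (Z * Z); t = X * X * (Z * Z) in
        a * (Z * Z * (Z * Z) - X * X * (X * X)) * (a * (Z * Z * (Z * Z) - X * X * (X * X))) ≡
        a * a * (S * S - + 4 * (t * t))
      Z′²≡ = ℤ-Solver.solve-∀
      identity : ∀ a b S t → let
          p = + 4 * (t * (a * a * S + b * t))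
          q = a * a * (S * S - + 4 * (t * t))
          U = a * (S * (a * a * S + + 2 * (b * t)) + + 4 * (a * a * (t * t)))
        in U * U ≡ a * a * (p * p + q * q) + b * (p * q)
      identity = ℤ-Solver.solve-∀

  dyadicPoint : ∀ n → DyadicPoint (+ 441) (+ 251038) n
  dyadicPoint zero    = record
    -- 54 = 2 * 27 has valuation 1, as `n = 0` requires.
    { c = + 27 ; Z = + 61 ; U = + 2659005
    ; c-odd = + 13 , refl ; Z-odd = + 30 , refl ; U-odd = + 1329502 , refl
    ; on-quartic = refl
    }
  dyadicPoint (suc n) = double (+ 220 , refl) (dyadicPoint n)

open 2-AdicPoints using (DyadicPoint; dyadicPoint; Odd⇒≢0)

open import Data.Integer.Base as ℤ using (+_)
import Data.Integer.Properties as ℤ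
open import Data.Rational.Base
open import Data.Rational.Properties
open import Data.Rational.Solver using (module +-*-Solver)
open import Data.Rational.Unnormalised.Base as ℚᵘ using (mkℚᵘ; *≡*)
import Data.Rational.Unnormalised.Properties as ℚᵘ
import Algebra.Definitions.RawSemiring
open Algebra.Definitions.RawSemiring +-*-rawSemiring using (_^_)
open +-*-Solver

-- Cancellation, zero products and square roots in ℚ.

private
  variable
    p q r : ℚ

*-cancelˡ : p ≢ 0ℚ → p * q ≡ p * r → q ≡ r
*-cancelˡ {p} {q} {r} p≢0 eq = begin
  q               ≡⟨ inverts q ⟨
  1/ p * (p * q)  ≡⟨ cong (1/ p *_) eq ⟩
  1/ p * (p * r)  ≡⟨ inverts r ⟩
  r               ∎
  where
  open ≡-Reasoning
  instance _ = ≢-nonZero p≢0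
  inverts : ∀ s → 1/ p * (p * s) ≡ s
  inverts s = trans (sym (*-assoc (1/ p) p s)) (trans (cong (_* s) (*-inverseˡ p)) (*-identityˡ s))

p*q≡0⇒p≡0∨q≡0 : p * q ≡ 0ℚ → p ≡ 0ℚ ⊎ q ≡ 0ℚ
p*q≡0⇒p≡0∨q≡0 {p} pq≡0 with p ≟ 0ℚ
... | yes p≡0 = inj₁ p≡0
... | no  p≢0 = inj₂ (*-cancelˡ p≢0 (trans pq≡0 (sym (*-zeroʳ p))))

*-≢0 : p ≢ 0ℚ → q ≢ 0ℚ → p * q ≢ 0ℚ
*-≢0 p≢0 q≢0 = [ p≢0 , q≢0 ]′ ∘ p*q≡0⇒p≡0∨q≡0

p-q≡0⇒p≡q : p - q ≡ 0ℚ → p ≡ q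
p-q≡0⇒p≡q {p} {q} eq = begin
  p          ≡⟨ solve 2 (λ p q → p := p :- q :+ q) refl p q ⟩
  p - q + q  ≡⟨ cong (_+ q) eq ⟩
  0ℚ + q     ≡⟨ +-identityˡ q ⟩
  q          ∎
  where open ≡-Reasoning

p+q≡0⇒p≡-q : p + q ≡ 0ℚ → p ≡ - q
p+q≡0⇒p≡-q {p} {q} eq =
  p-q≡0⇒p≡q (trans (solve 2 (λ p q → p :- :- q := p :+ q) refl p q) eq)

p²≡q²⇒p≡±q : p * p ≡ q * q → p ≡ q ⊎ p ≡ - q
p²≡q²⇒p≡±q {p} {q} eq = Sum.map p-q≡0⇒p≡q p+q≡0⇒p≡-q (p*q≡0⇒p≡0∨q≡0 (begin
  (p - q) * (p + q)  ≡⟨ solve 2 (λ p q → (p :- q) :* (p :+ q) := p :* p :- q :* q) refl p q ⟩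
  p * p - q * q      ≡⟨ cong (_- q * q) eq ⟩
  q * q - q * q      ≡⟨ +-inverseʳ (q * q) ⟩
  0ℚ                 ∎))
  where open ≡-Reasoning

p^2≡p*p : ∀ p → p ^ 2 ≡ p * p
p^2≡p*p p = cong (p *_) (*-identityʳ p)

-- The quadratic equation for x and its discriminant.

2ℚ 4ℚ : ℚ
2ℚ = fromℤ (+ 2)
4ℚ = fromℤ (+ 4)

2ℚ≢0 : 2ℚ ≢ 0ℚ
2ℚ≢0 ()

4ℚ≢0 : 4ℚ ≢ 0ℚ
4ℚ≢0 ()

-- For nonzero `x` this is x f(x).
quad : (α γ x : ℚ) → ℚ
quad α γ x = α * (x * x) + γ

-- The right-hand side of `C₄`, with rational coefficients so that `γ` can be replaced by
-- `- (α * (w * w))` in the degenerate case.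
quartic : (α γ z y : ℚ) → ℚ
quartic α γ z y =
    - 4ℚ * α ^ 3 * γ * z ^ 4 * y ^ 4
  + ( α ^ 4 * z ^ 8
    + 4ℚ * α ^ 3 * γ * z ^ 6
    - 2ℚ * α ^ 2 * γ ^ 2 * z ^ 4
    + 4ℚ * α * γ ^ 3 * z ^ 2
    + γ ^ 4
    ) * y ^ 2
  - 4ℚ * α * γ ^ 3 * z ^ 4

-- Multiplied by x y z², the equation f(x) f(y) = f(z)² becomes α k z² x² - m² y x + γ k z² = 0 with
-- `k = quad α γ y` and `m = quad α γ z`; the right-hand side here is its discriminant.
quartic≡discriminant : ∀ α γ z y → quartic α γ z y ≡
  (quad α γ z * quad α γ z * y) * (quad α γ z * quad α γ z * y)
  - 4ℚ * α * γ * ((z * z * quad α γ y) * (z * z * quad α γ y))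
quartic≡discriminant = solve 4 (λ α γ z y →
  let quad′ = λ x → α :* (x :* x) :+ γ in
    :- con 4ℚ :* α :^ 3 :* γ :* z :^ 4 :* y :^ 4
  :+ ( α :^ 4 :* z :^ 8
    :+ con 4ℚ :* α :^ 3 :* γ :* z :^ 6
    :- con 2ℚ :* α :^ 2 :* γ :^ 2 :* z :^ 4
    :+ con 4ℚ :* α :* γ :^ 3 :* z :^ 2
    :+ γ :^ 4
    ) :* y :^ 2
  :- con 4ℚ :* α :* γ :^ 3 :* z :^ 4
  := (quad′ z :* quad′ z :* y) :* (quad′ z :* quad′ z :* y)
     :- con 4ℚ :* α :* γ :* ((z :* z :* quad′ y) :* (z :* z :* quad′ y))) refl

-- Completing the square: 4 α k z² times the difference of the two sides is `s * s` minus the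
-- discriminant. This holds for arbitrary `k` and `m`.
quadratic-formula : ∀ α γ k m x y z → let D = 2ℚ * α * k * (z * z); s = D * x - m * m * y in
  α ≢ 0ℚ → k ≢ 0ℚ → z ≢ 0ℚ →
  s * s ≡ (m * m * y) * (m * m * y) - 4ℚ * α * γ * ((z * z * k) * (z * z * k)) →
  quad α γ x * k * (z * z) ≡ m * m * x * y
quadratic-formula α γ k m x y z α≢0 k≢0 z≢0 eq =
  *-cancelˡ 4αkz²≢0 (p-q≡0⇒p≡q (begin
  4ℚ * α * k * (z * z) * (quad α γ x * k * (z * z)) - 4ℚ * α * k * (z * z) * (m * m * x * y)
    ≡⟨ solve 7 (λ α γ k m x y z → let s = con 2ℚ :* α :* k :* (z :* z) :* x :- m :* m :* y in
         con 4ℚ :* α :* k :* (z :* z) :* ((α :* (x :* x) :+ γ) :* k :* (z :* z))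
           :- con 4ℚ :* α :* k :* (z :* z) :* (m :* m :* x :* y)
         := s :* s :- ((m :* m :* y) :* (m :* m :* y)
           :- con 4ℚ :* α :* γ :* ((z :* z :* k) :* (z :* z :* k)))) refl α γ k m x y z ⟩
  _ ≡⟨ cong (_- d) eq ⟩
  d - d ≡⟨ +-inverseʳ d ⟩
  0ℚ ∎))
  where
  open ≡-Reasoning
  d = (m * m * y) * (m * m * y) - 4ℚ * α * γ * ((z * z * k) * (z * z * k))
  4αkz²≢0 : 4ℚ * α * k * (z * z) ≢ 0ℚ
  4αkz²≢0 = *-≢0 (*-≢0 (*-≢0 4ℚ≢0 α≢0) k≢0) (*-≢0 z≢0 z≢0)

-- Fibres of f, and nontrivial solutions from points of C₄.

module _ (A C : ℤ) where

  private
    α = fromℤ A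
    γ = fromℤ C

  f-*-self : ∀ x .{{_ : NonZero x}} → f A C x * x ≡ quad α γ x
  f-*-self x = begin
    (α * x + γ * 1/ x) * x        ≡⟨ solve 4 (λ α γ x i → (α :* x :+ γ :* i) :* x := α :* (x :* x) :+ γ :* (x :* i)) refl α γ x (1/ x) ⟩
    α * (x * x) + γ * (x * 1/ x)  ≡⟨ cong (λ t → α * (x * x) + γ * t) (*-inverseʳ x) ⟩
    α * (x * x) + γ * 1ℚ          ≡⟨ cong (λ t → α * (x * x) + t) (*-identityʳ γ) ⟩
    quad α γ x                    ∎
    where open ≡-Reasoning

  -- After clearing denominators f(y) = f(z) is quadratic in `y`, with roots `z` and
  -- `u = γ / (α z)`, since the product of the roots is γ/α.
  f-fibre : ∀ {u} y z .{{_ : NonZero y}} .{{_ : NonZero z}} → α ≢ 0ℚ → z ≢ 0ℚ →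
    γ ≡ α * z * u → f A C y ≡ f A C z → y ≡ z ⊎ y ≡ u
  f-fibre {u} y z α≢0 z≢0 γ≡αzu fy≡fz =
    Sum.map p-q≡0⇒p≡q p-q≡0⇒p≡q (p*q≡0⇒p≡0∨q≡0 (*-cancelˡ (*-≢0 α≢0 z≢0) (begin
      α * z * ((y - z) * (y - u))
        ≡⟨ solve 4 (λ α z u y → α :* z :* ((y :- z) :* (y :- u))
             := (α :* (y :* y) :+ α :* z :* u) :* z :- (α :* (z :* z) :+ α :* z :* u) :* y) refl α z u y ⟩
      quad α (α * z * u) y * z - quad α (α * z * u) z * y
        ≡⟨ cong (λ γ → quad α γ y * z - quad α γ z * y) γ≡αzu ⟨
      quad α γ y * z - quad α γ z * y
        ≡⟨ cong₂ (λ s t → s * z - t * y) (f-*-self y) (f-*-self z) ⟨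
      f A C y * y * z - f A C z * z * y
        ≡⟨ cong (λ t → t * y * z - f A C z * z * y) fy≡fz ⟩
      f A C z * y * z - f A C z * z * y
        ≡⟨ solve 3 (λ g y z → g :* y :* z :- g :* z :* y := con 0ℚ) refl (f A C z) y z ⟩
      0ℚ
        ≡⟨ *-zeroʳ (α * z) ⟨
      α * z * 0ℚ ∎)))
    where open ≡-Reasoning

  f-odd : ∀ x .{{_ : NonZero x}} .{{_ : NonZero (- x)}} → x ≢ 0ℚ → f A C (- x) ≡ - f A C x
  f-odd x x≢0 = *-cancelˡ x≢0 (begin
    x * f A C (- x)          ≡⟨ solve 2 (λ x g → x :* g := :- (g :* :- x)) refl x (f A C (- x)) ⟩
    - (f A C (- x) * (- x))  ≡⟨ cong -_ (f-*-self (- x)) ⟩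
    - quad α γ (- x)         ≡⟨ solve 3 (λ α γ x → :- (α :* (:- x :* :- x) :+ γ) := :- (α :* (x :* x) :+ γ)) refl α γ x ⟩
    - quad α γ x             ≡⟨ cong -_ (f-*-self x) ⟨
    - (f A C x * x)          ≡⟨ solve 2 (λ x g → :- (g :* x) := x :* :- g) refl x (f A C x) ⟩
    x * - f A C x            ∎)
    where open ≡-Reasoning

  -- As f is odd, `f-fibre` applies to `- z`, whose companion root is `- u`.
  f-fibre-neg : ∀ {u} y z .{{_ : NonZero y}} .{{_ : NonZero z}} → α ≢ 0ℚ → z ≢ 0ℚ →
    γ ≡ α * z * u → f A C y ≡ - f A C z → y ≡ - z ⊎ y ≡ - u
  f-fibre-neg {u} y z α≢0 z≢0 γ≡αzu fy≡-fz =
    f-fibre y (- z) {{_}} {{ -z-nonZero }} α≢0 -z≢0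
      (trans γ≡αzu (solve 3 (λ α z u → α :* z :* u := α :* :- z :* :- u) refl α z u))
      (trans fy≡-fz (sym (f-odd z {{_}} {{ -z-nonZero }} z≢0)))
    where
    -z≢0 : - z ≢ 0ℚ
    -z≢0 -z≡0 = z≢0 (neg-injective -z≡0)
    -z-nonZero : NonZero (- z)
    -z-nonZero = ≢-nonZero -z≢0

  root⇒nontrivial : ∀ {u x y z} → α ≢ 0ℚ → x ≢ 0ℚ → y ≢ 0ℚ → z ≢ 0ℚ → γ ≡ α * z * u →
    quad α γ z ≢ 0ℚ → y ≢ z → y ≢ u → y ≢ - z → y ≢ - u →
    quad α γ x * quad α γ y * (z * z) ≡ quad α γ z * quad α γ z * x * y →
    NontrivialSolution A C (x , y , z)
  root⇒nontrivial {u} {x} {y} {z} α≢0 x≢0 y≢0 z≢0 γ≡αzu m≢0 y≢z y≢u y≢-z y≢-u x-root = record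
    { equation = fxfy≡fz²
    ; fx≢fy    = fx≢fy
    ; fz≢0     = λ fz≡0 → m≢0 (trans (sym (f-*-self z)) (trans (cong (_* z) fz≡0) (*-zeroˡ z)))
    }
    where
    open ≡-Reasoning
    instance
      _ = ≢-nonZero x≢0
      _ = ≢-nonZero y≢0
      _ = ≢-nonZero z≢0

    fx fy fz : ℚ
    fx = f A C x
    fy = f A C y
    fz = f A C z

    fxfy≡fz² : fx * fy ≡ fz ^ 2
    fxfy≡fz² = *-cancelˡ (*-≢0 (*-≢0 x≢0 y≢0) (*-≢0 z≢0 z≢0)) (begin
      x * y * (z * z) * (fx * fy)
        ≡⟨ solve 5 (λ x y z fx fy → x :* y :* (z :* z) :* (fx :* fy) := fx :* x :* (fy :* y) :* (z :* z)) refl x y z fx fy ⟩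
      fx * x * (fy * y) * (z * z)
        ≡⟨ cong₂ (λ s t → s * t * (z * z)) (f-*-self x) (f-*-self y) ⟩
      quad α γ x * quad α γ y * (z * z)
        ≡⟨ x-root ⟩
      quad α γ z * quad α γ z * x * y
        ≡⟨ cong (λ m → m * m * x * y) (f-*-self z) ⟨
      fz * z * (fz * z) * x * y
        ≡⟨ solve 4 (λ x y z fz → fz :* z :* (fz :* z) :* x :* y := x :* y :* (z :* z) :* (fz :* fz)) refl x y z fz ⟩
      x * y * (z * z) * (fz * fz)
        ≡⟨ cong (x * y * (z * z) *_) (p^2≡p*p fz) ⟨
      x * y * (z * z) * fz ^ 2 ∎)

    -- If f(x) = f(y), the equation gives f(y)² = f(z)², so f(y) = ± f(z) and `y` is one of the four
    -- excluded values.
    fx≢fy : fx ≢ fy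
    fx≢fy fx≡fy =
      [ [ y≢z , y≢u ]′ ∘ f-fibre y z α≢0 z≢0 γ≡αzu
      , [ y≢-z , y≢-u ]′ ∘ f-fibre-neg y z α≢0 z≢0 γ≡αzu
      ]′ (p²≡q²⇒p≡±q (trans (cong (_* fy) (sym fx≡fy)) (trans fxfy≡fz² (p^2≡p*p fz))))

  solution : ∀ {u y z v} → α ≢ 0ℚ → γ ≢ 0ℚ → y ≢ 0ℚ → z ≢ 0ℚ → γ ≡ α * z * u →
    quad α γ y ≢ 0ℚ → quad α γ z ≢ 0ℚ → y ≢ z → y ≢ u → y ≢ - z → y ≢ - u →
    C₄ A C z (y , v) → ∃[ x ] NontrivialSolution A C (x , y , z)
  solution {u} {y} {z} {v} α≢0 γ≢0 y≢0 z≢0 γ≡αzu k≢0 m≢0 y≢z y≢u y≢-z y≢-u pt = x ,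
    root⇒nontrivial α≢0 x≢0 y≢0 z≢0 γ≡αzu m≢0 y≢z y≢u y≢-z y≢-u x-root
    where
    open ≡-Reasoning
    k m D D⁻¹ x : ℚ
    k = quad α γ y
    m = quad α γ z
    D = 2ℚ * α * k * (z * z)
    D≢0 : D ≢ 0ℚ
    D≢0 = *-≢0 (*-≢0 (*-≢0 2ℚ≢0 α≢0) k≢0) (*-≢0 z≢0 z≢0)
    D⁻¹ = (1/ D) {{≢-nonZero D≢0}}
    -- The quadratic formula, with `v` as square root of the discriminant.
    x = D⁻¹ * (m * m * y + v)

    Dx-mmy≡v : D * x - m * m * y ≡ v
    Dx-mmy≡v = begin
      D * x - m * m * y
        ≡⟨ solve 4 (λ d i n v → d :* (i :* (n :+ v)) :- n := d :* i :* (n :+ v) :- n) refl D D⁻¹ (m * m * y) v ⟩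
      D * D⁻¹ * (m * m * y + v) - m * m * y
        ≡⟨ cong (λ t → t * (m * m * y + v) - m * m * y) (*-inverseʳ D {{≢-nonZero D≢0}}) ⟩
      1ℚ * (m * m * y + v) - m * m * y
        ≡⟨ solve 2 (λ n v → con 1ℚ :* (n :+ v) :- n := v) refl (m * m * y) v ⟩
      v ∎

    x-root : quad α γ x * k * (z * z) ≡ m * m * x * y
    x-root = quadratic-formula α γ k m x y z α≢0 k≢0 z≢0 (begin
      (D * x - m * m * y) * (D * x - m * m * y)  ≡⟨ cong₂ _*_ Dx-mmy≡v Dx-mmy≡v ⟩
      v * v                                      ≡⟨ p^2≡p*p v ⟨
      v ^ 2                                      ≡⟨ pt ⟩
      quartic α γ z y                            ≡⟨ quartic≡discriminant α γ z y ⟩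
      _                                          ∎)

    -- At x = 0 only the nonzero constant term γ k z² of the quadratic would remain.
    x≢0 : x ≢ 0ℚ
    x≢0 x≡0 = *-≢0 (*-≢0 γ≢0 k≢0) (*-≢0 z≢0 z≢0) (begin
      γ * k * (z * z)            ≡⟨ solve 4 (λ α γ k z → γ :* k :* (z :* z) := (α :* (con 0ℚ :* con 0ℚ) :+ γ) :* k :* (z :* z)) refl α γ k z ⟩
      quad α γ 0ℚ * k * (z * z)  ≡⟨ cong (λ x → quad α γ x * k * (z * z)) x≡0 ⟨
      quad α γ x * k * (z * z)   ≡⟨ x-root ⟩
      m * m * x * y              ≡⟨ cong (λ x → m * m * x * y) x≡0 ⟩
      m * m * 0ℚ * y             ≡⟨ solve 2 (λ m y → m :* m :* con 0ℚ :* y := con 0ℚ) refl m y ⟩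
      0ℚ                         ∎)

  C₄-fibre : ∀ {z y v} → C₄ A C z (y , v) → ∃[ vs ] (∀ {v′} → C₄ A C z (y , v′) → v′ ∈ vs)
  C₄-fibre {z} {y} {v} pt = v ∷ - v ∷ [] , λ {v′} pt′ →
    [ here , there ∘ here ]′ (p²≡q²⇒p≡±q (trans (sym (p^2≡p*p v′)) (trans {j = quartic α γ z y} pt′ (trans (sym pt) (p^2≡p*p v)))))

  quad-roots : ∀ {y y₀} → α ≢ 0ℚ → quad α γ y₀ ≡ 0ℚ → quad α γ y ≡ 0ℚ → y ≡ y₀ ⊎ y ≡ - y₀
  quad-roots {y} {y₀} α≢0 eq₀ eq = p²≡q²⇒p≡±q (*-cancelˡ α≢0 (+-cancelʳ (trans eq (sym eq₀))))
    where
    +-cancelʳ : ∀ {p q r} → p + r ≡ q + r → p ≡ q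
    +-cancelʳ {p} {q} {r} p+r≡q+r = p-q≡0⇒p≡q (begin
      p - q              ≡⟨ solve 3 (λ p q r → p :- q := p :+ r :- (q :+ r)) refl p q r ⟩
      p + r - (q + r)    ≡⟨ cong (_- (q + r)) p+r≡q+r ⟩
      q + r - (q + r)    ≡⟨ +-inverseʳ (q + r) ⟩
      0ℚ                 ∎)
      where open ≡-Reasoning

  -- The roots of α y² + γ, if rational, are known only once one of them turns up.
  avoid-roots : α ≢ 0ℚ → {P : Pred ℚ ℓ} → Infinite P → Infinite (λ y → quad α γ y ≢ 0ℚ × P y)
  avoid-roots α≢0 inf ys with inf ys
  ... | y , y∉ys , py with quad α γ y ≟ 0ℚ
  ...   | no  qy≢0 = y , y∉ys , qy≢0 , py
  ...   | yes qy≡0 with inf (y ∷ - y ∷ ys)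
  ...     | y′ , y′∉ , py′ =
    y′ , y′∉ ∘ there ∘ there ,
    (λ qy′≡0 → [ y′∉ ∘ here , y′∉ ∘ there ∘ here ]′ (quad-roots α≢0 qy≡0 qy′≡0)) , py′

  nondegenerate : ∀ {z} → α ≢ 0ℚ → γ ≢ 0ℚ → z ≢ 0ℚ → quad α γ z ≢ 0ℚ →
    Infinite (C₄ A C z) → Infinite (NontrivialSolution A C)
  nondegenerate {z} α≢0 γ≢0 z≢0 m≢0 inf xyzs =
    (x , y , z) , y∉ys ∘ there ∘ there ∘ there ∘ there ∘ there ∘ ∈-map⁺ (proj₁ ∘ proj₂) , xyz-solution
    where
    αz≢0 : α * z ≢ 0ℚ
    αz≢0 = *-≢0 α≢0 z≢0
    u : ℚ
    u = (1/ (α * z)) {{≢-nonZero αz≢0}} * γ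
    γ≡αzu : γ ≡ α * z * u
    γ≡αzu = begin
      γ                                              ≡⟨ *-identityˡ γ ⟨
      1ℚ * γ                                         ≡⟨ cong (_* γ) (*-inverseʳ (α * z) {{≢-nonZero αz≢0}}) ⟨
      α * z * (1/ (α * z)) {{≢-nonZero αz≢0}} * γ    ≡⟨ *-assoc (α * z) _ γ ⟩
      α * z * u                                      ∎
      where open ≡-Reasoning
    -- Besides the degenerate values, `y` avoids the middle coordinates of the listed triples, which
    -- makes the new triple differ from all of them.
    point = avoid-roots α≢0 (Infinite-dom _≟_ (λ {y} {v} → C₄-fibre {z} {y} {v}) inf)
              (0ℚ ∷ z ∷ u ∷ - z ∷ - u ∷ map (proj₁ ∘ proj₂) xyzs)
    y = proj₁ point
    y∉ys = proj₁ (proj₂ point)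
    v = proj₁ (proj₂ (proj₂ (proj₂ point)))
    xyz = solution {u} {y} {z} {v} α≢0 γ≢0 (y∉ys ∘ here) z≢0 γ≡αzu (proj₁ (proj₂ (proj₂ point))) m≢0
            (y∉ys ∘ there ∘ here) (y∉ys ∘ there ∘ there ∘ here)
            (y∉ys ∘ there ∘ there ∘ there ∘ here) (y∉ys ∘ there ∘ there ∘ there ∘ there ∘ here)
            (proj₂ (proj₂ (proj₂ (proj₂ point))))
    x = proj₁ xyz
    xyz-solution = proj₂ xyz

-- Transfer from integers to rationals.

toℚᵘ-fromℤ : ∀ i → toℚᵘ (fromℤ i) ℚᵘ.≃ mkℚᵘ i 0
toℚᵘ-fromℤ i = toℚᵘ-fromℚᵘ (mkℚᵘ i 0)

fromℤ-+ : ∀ i j → fromℤ (i ℤ.+ j) ≡ fromℤ i + fromℤ j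
fromℤ-+ i j = toℚᵘ-injective (begin
  toℚᵘ (fromℤ (i ℤ.+ j))               ≈⟨ toℚᵘ-fromℤ (i ℤ.+ j) ⟩
  mkℚᵘ (i ℤ.+ j) 0                     ≡⟨ cong₂ (λ i j → mkℚᵘ (i ℤ.+ j) 0) (ℤ.*-identityʳ i) (ℤ.*-identityʳ j) ⟨
  mkℚᵘ i 0 ℚᵘ.+ mkℚᵘ j 0               ≈⟨ ℚᵘ.+-cong (toℚᵘ-fromℤ i) (toℚᵘ-fromℤ j) ⟨
  toℚᵘ (fromℤ i) ℚᵘ.+ toℚᵘ (fromℤ j)   ≈⟨ toℚᵘ-homo-+ (fromℤ i) (fromℤ j) ⟨
  toℚᵘ (fromℤ i + fromℤ j)             ∎)
  where open import Relation.Binary.Reasoning.Setoid ℚᵘ.≃-setoid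

fromℤ-* : ∀ i j → fromℤ (i ℤ.* j) ≡ fromℤ i * fromℤ j
fromℤ-* i j = toℚᵘ-injective (begin
  toℚᵘ (fromℤ (i ℤ.* j))               ≈⟨ toℚᵘ-fromℤ (i ℤ.* j) ⟩
  mkℚᵘ i 0 ℚᵘ.* mkℚᵘ j 0               ≈⟨ ℚᵘ.*-cong (toℚᵘ-fromℤ i) (toℚᵘ-fromℤ j) ⟨
  toℚᵘ (fromℤ i) ℚᵘ.* toℚᵘ (fromℤ j)   ≈⟨ toℚᵘ-homo-* (fromℤ i) (fromℤ j) ⟨
  toℚᵘ (fromℤ i * fromℤ j)             ∎)
  where open import Relation.Binary.Reasoning.Setoid ℚᵘ.≃-setoid

-- Brings the reduced numerator and denominator of `y` into an integer equation, the form to which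
-- `X/Z-small` applies.
cross-multiply : ∀ y {i j} → y * fromℤ j ≡ fromℤ i → ↥ y ℤ.* j ≡ i ℤ.* ↧ y
cross-multiply y@record{} {i} {j} yj≡i = begin
  ↥ y ℤ.* j                ≡⟨ ℤ.*-identityʳ (↥ y ℤ.* j) ⟨
  ↥ y ℤ.* j ℤ.* + 1        ≡⟨ ℚᵘ.drop-*≡* yj≃i ⟩
  i ℤ.* ℚᵘ.↧ (toℚᵘ y ℚᵘ.* mkℚᵘ j 0)  ≡⟨ cong (i ℤ.*_) (cong +_ (ℕ.*-identityʳ (↧ₙ y))) ⟩
  i ℤ.* ↧ y                ∎
  where
  open ≡-Reasoning
  yj≃i : toℚᵘ y ℚᵘ.* mkℚᵘ j 0 ℚᵘ.≃ mkℚᵘ i 0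
  yj≃i = ℚᵘ.≃-trans (ℚᵘ.*-cong (ℚᵘ.≃-refl {toℚᵘ y}) (ℚᵘ.≃-sym (toℚᵘ-fromℤ j)))
        (ℚᵘ.≃-trans (ℚᵘ.≃-sym (toℚᵘ-homo-* y (fromℤ j)))
        (ℚᵘ.≃-trans (ℚᵘ.≃-reflexive (cong toℚᵘ yj≡i)) (toℚᵘ-fromℤ i)))

fromℤ-≢0 : ∀ {i} → i ≢ 0ℤ → fromℤ i ≢ 0ℚ
fromℤ-≢0 {i} i≢0 eq = i≢0 (begin
  i              ≡⟨ ℤ.*-identityʳ i ⟨
  i ℤ.* + 1      ≡⟨ cross-multiply 0ℚ {i} {0ℤ} (sym eq) ⟨
  0ℤ             ∎)
  where open ≡-Reasoning

-- Infinitely many rational points on the symmetric quartic.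

SymmetricQuartic : (a b : ℚ) → Pred (ℚ × ℚ) _
SymmetricQuartic a b (y , u) = u * u ≡ a * a * (y * y * (y * y) + 1ℚ) + b * (y * y)

-- Passage to the chart Z = 1: the homogeneous equation has weights 1, 1, 2 in `x`, `z`, `u`, and
-- `r` is the inverse of `z`.
symmetricQuartic-scale : ∀ a b x z u r → r * z ≡ 1ℚ →
  u * u ≡ a * a * (x * x * (x * x) + z * z * (z * z)) + b * (x * x * (z * z)) →
  SymmetricQuartic a b (r * x , r * r * u)
symmetricQuartic-scale a b x z u r rz≡1 eq = begin
  r * r * u * (r * r * u)
    ≡⟨ solve 2 (λ r u → r :* r :* u :* (r :* r :* u) := r :* r :* (r :* r) :* (u :* u)) refl r u ⟩
  r * r * (r * r) * (u * u)
    ≡⟨ cong (r * r * (r * r) *_) eq ⟩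
  r * r * (r * r) * (a * a * (x * x * (x * x) + z * z * (z * z)) + b * (x * x * (z * z)))
    ≡⟨ solve 5 (λ a b x z r → let y = r :* x; t = r :* z in
         r :* r :* (r :* r) :* (a :* a :* (x :* x :* (x :* x) :+ z :* z :* (z :* z)) :+ b :* (x :* x :* (z :* z)))
         := a :* a :* (y :* y :* (y :* y) :+ t :* t :* (t :* t)) :+ b :* (y :* y :* (t :* t))) refl a b x z r ⟩
  homogeneous (r * z)
    ≡⟨ cong homogeneous rz≡1 ⟩
  homogeneous 1ℚ
    ≡⟨ solve 3 (λ a b y →
         a :* a :* (y :* y :* (y :* y) :+ con 1ℚ) :+ b :* (y :* y :* con 1ℚ)
         := a :* a :* (y :* y :* (y :* y) :+ con 1ℚ) :+ b :* (y :* y)) refl a b (r * x) ⟩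
  _ ∎
  where
  open ≡-Reasoning
  homogeneous : ℚ → ℚ
  homogeneous t = let y = r * x in a * a * (y * y * (y * y) + t * t * (t * t)) + b * (y * y * (t * t))

dyadicPoint⇒rational : ∀ {a b n} → DyadicPoint a b n →
  ∃[ y ] n ℕ.< ℤ.∣ ↥ y ∣ × ∃[ u ] SymmetricQuartic (fromℤ a) (fromℤ b) (y , u)
dyadicPoint⇒rational {a} {b} {n} pt =
  y , X/Z-small {↥ y} {↧ y} (λ ()) (cross-multiply y {X} {Z} yz≡x) ,
  Z⁻¹ * Z⁻¹ * fromℤ U , symmetricQuartic-scale (fromℤ a) (fromℤ b) (fromℤ X) (fromℤ Z) (fromℤ U) Z⁻¹ Z⁻¹Z≡1 on-quarticℚ
  where
  open DyadicPoint pt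
  open ≡-Reasoning
  z≢0 : fromℤ Z ≢ 0ℚ
  z≢0 = fromℤ-≢0 (Odd⇒≢0 Z-odd)
  Z⁻¹ y : ℚ
  Z⁻¹ = (1/ fromℤ Z) {{≢-nonZero z≢0}}
  y = Z⁻¹ * fromℤ X
  Z⁻¹Z≡1 : Z⁻¹ * fromℤ Z ≡ 1ℚ
  Z⁻¹Z≡1 = *-inverseˡ (fromℤ Z) {{≢-nonZero z≢0}}
  yz≡x : y * fromℤ Z ≡ fromℤ X
  yz≡x = begin
    Z⁻¹ * fromℤ X * fromℤ Z    ≡⟨ solve 3 (λ r x z → r :* x :* z := r :* z :* x) refl Z⁻¹ (fromℤ X) (fromℤ Z) ⟩
    Z⁻¹ * fromℤ Z * fromℤ X    ≡⟨ cong (_* fromℤ X) Z⁻¹Z≡1 ⟩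
    1ℚ * fromℤ X             ≡⟨ *-identityˡ (fromℤ X) ⟩
    fromℤ X                  ∎
  fromℤ-*² : ∀ i j → fromℤ (i ℤ.* i ℤ.* (j ℤ.* j)) ≡ fromℤ i * fromℤ i * (fromℤ j * fromℤ j)
  fromℤ-*² i j = trans (fromℤ-* (i ℤ.* i) (j ℤ.* j)) (cong₂ _*_ (fromℤ-* i i) (fromℤ-* j j))
  on-quarticℚ : fromℤ U * fromℤ U ≡
    fromℤ a * fromℤ a * (fromℤ X * fromℤ X * (fromℤ X * fromℤ X) + fromℤ Z * fromℤ Z * (fromℤ Z * fromℤ Z))
    + fromℤ b * (fromℤ X * fromℤ X * (fromℤ Z * fromℤ Z))
  on-quarticℚ = trans (sym (fromℤ-* U U)) (trans (cong fromℤ on-quartic)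
    (trans (fromℤ-+ (a ℤ.* a ℤ.* (X ℤ.* X ℤ.* (X ℤ.* X) ℤ.+ Z ℤ.* Z ℤ.* (Z ℤ.* Z))) (b ℤ.* (X ℤ.* X ℤ.* (Z ℤ.* Z))))
      (cong₂ _+_
        (trans (fromℤ-* (a ℤ.* a) (X ℤ.* X ℤ.* (X ℤ.* X) ℤ.+ Z ℤ.* Z ℤ.* (Z ℤ.* Z)))
          (cong₂ _*_ (fromℤ-* a a)
            (trans (fromℤ-+ (X ℤ.* X ℤ.* (X ℤ.* X)) (Z ℤ.* Z ℤ.* (Z ℤ.* Z))) (cong₂ _+_ (fromℤ-*² X X) (fromℤ-*² Z Z)))))
        (trans (fromℤ-* b (X ℤ.* X ℤ.* (Z ℤ.* Z))) (cong (fromℤ b *_) (fromℤ-*² X Z))))))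

441ℚ 251038ℚ : ℚ
441ℚ    = fromℤ (+ 441)
251038ℚ = fromℤ (+ 251038)

symmetricQuartic-infinite : Infinite (λ y → ∃[ u ] SymmetricQuartic 441ℚ 251038ℚ (y , u))
symmetricQuartic-infinite ys = y , y∉ys , point
  where
  heights : List ℕ
  heights = map (ℤ.∣_∣ ∘ ↥_) ys
  -- The level is the largest numerator in `ys`, or 0 if the list is empty; the new numerator
  -- strictly exceeds it.
  large = dyadicPoint⇒rational (dyadicPoint (max 0 heights))
  y = proj₁ large
  point = proj₂ (proj₂ large)
  y∉ys : y ∉ ys
  y∉ys y∈ys = ℕ.<⇒≱ (proj₁ (proj₂ large)) (All.lookup (xs≤max 0 heights) (∈-map⁺ (ℤ.∣_∣ ∘ ↥_) y∈ys))

-- For A = 1, C = -1, z = 7/3, the quartic C₄ is the above one with u = 81/2 v.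
7/3ℚ 2/81ℚ : ℚ
7/3ℚ  = + 7 / 3
2/81ℚ = + 2 / 81

-- Once γ = - α w², scaling z and y by `w` multiplies the quartic by α⁴ w¹⁰, so v scales by α² w⁵.
-- The factor 2/81 matches the leading coefficients: 441 * 2/81 = 98/9 = 2 (7/3)².
quartic-scale : ∀ α w y u → SymmetricQuartic 441ℚ 251038ℚ (y , u) →
  (α ^ 2 * w ^ 5 * 2/81ℚ * u) ^ 2 ≡ quartic α (- (α * (w * w))) (7/3ℚ * w) (w * y)
quartic-scale α w y u eq = begin
  (α ^ 2 * w ^ 5 * 2/81ℚ * u) ^ 2
    ≡⟨ solve 3 (λ α w u → (α :^ 2 :* w :^ 5 :* con 2/81ℚ :* u) :^ 2
                 := (α :^ 2 :* w :^ 5 :* con 2/81ℚ) :^ 2 :* (u :* u)) refl α w u ⟩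
  (α ^ 2 * w ^ 5 * 2/81ℚ) ^ 2 * (u * u)
    ≡⟨ cong ((α ^ 2 * w ^ 5 * 2/81ℚ) ^ 2 *_) eq ⟩
  (α ^ 2 * w ^ 5 * 2/81ℚ) ^ 2 * (441ℚ * 441ℚ * (y * y * (y * y) + 1ℚ) + 251038ℚ * (y * y))
    ≡⟨ solve 3 (λ α w y →
         let γ = :- (α :* (w :* w)); z = con 7/3ℚ :* w; Y = w :* y in
         (α :^ 2 :* w :^ 5 :* con 2/81ℚ) :^ 2
           :* (con 441ℚ :* con 441ℚ :* (y :* y :* (y :* y) :+ con 1ℚ) :+ con 251038ℚ :* (y :* y))
         := :- con 4ℚ :* α :^ 3 :* γ :* z :^ 4 :* Y :^ 4
            :+ ( α :^ 4 :* z :^ 8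
              :+ con 4ℚ :* α :^ 3 :* γ :* z :^ 6
              :- con 2ℚ :* α :^ 2 :* γ :^ 2 :* z :^ 4
              :+ con 4ℚ :* α :* γ :^ 3 :* z :^ 2
              :+ γ :^ 4
              ) :* Y :^ 2
            :- con 4ℚ :* α :* γ :^ 3 :* z :^ 4) refl α w y ⟩
  quartic α (- (α * (w * w))) (7/3ℚ * w) (w * y) ∎
  where open ≡-Reasoning

-- The degenerate case f(w) = 0.

module _ {A C : ℤ} {w : ℚ} (α≢0 : fromℤ A ≢ 0ℚ) (w≢0 : w ≢ 0ℚ)
         (degenerate : quad (fromℤ A) (fromℤ C) w ≡ 0ℚ) where

  private
    α = fromℤ A
    γ = fromℤ C

  γ≡-αw² : γ ≡ - (α * (w * w))
  γ≡-αw² = p+q≡0⇒p≡-q (trans (+-comm γ (α * (w * w))) degenerate)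

  quad-7/3w≢0 : quad α γ (7/3ℚ * w) ≢ 0ℚ
  -- Since γ = - α w², the value is (49/9 - 1) α w².
  quad-7/3w≢0 eq = *-≢0 {p = 7/3ℚ * 7/3ℚ - 1ℚ} (λ ()) (*-≢0 α≢0 (*-≢0 w≢0 w≢0)) (begin
    (7/3ℚ * 7/3ℚ - 1ℚ) * (α * (w * w))
      ≡⟨ solve 2 (λ α w → (con 7/3ℚ :* con 7/3ℚ :- con 1ℚ) :* (α :* (w :* w))
           := α :* (con 7/3ℚ :* w :* (con 7/3ℚ :* w)) :+ :- (α :* (w :* w))) refl α w ⟩
    quad α (- (α * (w * w))) (7/3ℚ * w)
      ≡⟨ cong (λ γ → quad α γ (7/3ℚ * w)) γ≡-αw² ⟨
    quad α γ (7/3ℚ * w)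
      ≡⟨ eq ⟩
    0ℚ ∎)
    where open ≡-Reasoning

  C₄-7/3w-infinite : Infinite (C₄ A C (7/3ℚ * w))
  C₄-7/3w-infinite yvs = (w * y , v) , wyv∉yvs ,
    trans (quartic-scale α w y u on-quartic) (cong (λ γ → quartic α γ (7/3ℚ * w) (w * y)) (sym γ≡-αw²))
    where
    w⁻¹ : ℚ
    w⁻¹ = (1/ w) {{≢-nonZero w≢0}}
    -- The listed first coordinates are divided by `w`, because the new point has first coordinate
    -- `w * y`.
    point = symmetricQuartic-infinite (map ((w⁻¹ *_) ∘ proj₁) yvs)
    y u v : ℚ
    y = proj₁ point
    u = proj₁ (proj₂ (proj₂ point))
    on-quartic = proj₂ (proj₂ (proj₂ point))
    v = α ^ 2 * w ^ 5 * 2/81ℚ * u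
    w⁻¹wy≡y : w⁻¹ * (w * y) ≡ y
    w⁻¹wy≡y = trans (sym (*-assoc w⁻¹ w y))
      (trans (cong (_* y) (*-inverseˡ w {{≢-nonZero w≢0}})) (*-identityˡ y))
    wyv∉yvs : (w * y , v) ∉ yvs
    wyv∉yvs wyv∈yvs = proj₁ (proj₂ point)
      (subst (_∈ map ((w⁻¹ *_) ∘ proj₁) yvs) w⁻¹wy≡y (∈-map⁺ ((w⁻¹ *_) ∘ proj₁) wyv∈yvs))

theorem1p4 : (A C : ℤ) → A ≢ 0ℤ → C ≢ 0ℤ →
    (∃[ z ] z ≢ 0ℚ × Infinite (C₄ A C z)) →
    Infinite (NontrivialSolution A C)
theorem1p4 A C A≢0 C≢0 (z , z≢0 , inf) with quad (fromℤ A) (fromℤ C) z ≟ 0ℚ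
... | no  m≢0 = nondegenerate A C (fromℤ-≢0 A≢0) (fromℤ-≢0 C≢0) z≢0 m≢0 inf
... | yes m≡0 = nondegenerate A C (fromℤ-≢0 A≢0) (fromℤ-≢0 C≢0)
  (*-≢0 {p = 7/3ℚ} (λ ()) z≢0) (quad-7/3w≢0 {A} {C} α≢0 z≢0 m≡0) (C₄-7/3w-infinite {A} {C} α≢0 z≢0 m≡0)
  where α≢0 = fromℤ-≢0 A≢0
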